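{- Let $k, \ell, t$ be positive integers with $1 \leq t \leq \ell-1$. There exists $n_0(k,\ell,t)$ such that for every integer $n \geq n_0(k,\ell,t)$ the following holds: if $\mathcal{P}$ is a $t$-intersecting family of $(k,\ell)$-subpartitions of $[n]$, then $$|\mathcal{P}| \leq \frac{1}{(\ell-t)!} \prod_{i=t}^{\ell-1}\binom{n-ik}{k}.$$ Moreover, this bound is attained only by a canonical $t$-intersecting family of $(k,\ell)$-subpartitions, i.e. a family consisting of all $(k,\ell)$-subpartitions of $[n]$ that contain a fixed set of $t$ pairwise disjoint $k$-subsets of $[n]$ among their classes.
   Context: Let $[n]=\{1,\dots,n\}$. A $(k,\ell)$-subpartition of $[n]$ is a set $P=\{P_1,\dots,P_\ell\}$ of $\ell$ pairwise disjoint $k$-subsets of $[n]$ (called classes). Two $(k,\ell)$-subpartitions $P$ and $Q$ are $t$-intersecting if they have at least $t$ classes in common, i.e. the classes can be ordered so that $P_i=Q_i$ for $i=1,\dots,t$. A family is $t$-intersecting if every two of its members are $t$-intersecting. -}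

module Defs where

open import Data.Nat using (ℕ; _∸_; _*_)
open import Data.Nat.Combinatorics using (_C_)
open import Data.List using (List; length; map; drop; upTo)
open import Data.Nat.ListAction using (product)
open import Data.List.Relation.Unary.All using (All)
open import Data.List.Relation.Unary.Any using (Any)
open import Data.List.Relation.Unary.AllPairs using (AllPairs)
open import Data.List.Relation.Binary.Subset.Propositional using (_⊆_)
open import Data.List.Relation.Binary.Permutation.Propositional using (_↭_)
open import Data.Fin.Subset using (Subset; ∣_∣; _∩_; ⊥)
open import Data.Product using (Σ; _×_; ∃-syntax)
open import Relation.Binary.PropositionalEquality using (_≡_; _≢_)
open import Relation.Nullary using (¬_)
open import Function.Bundles using (_⇔_)

Disjoint : ∀ {n} → Subset n → Subset n → Set
Disjoint A B = A ∩ B ≡ ⊥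

-- A (k,ℓ)-subpartition of [n], represented as a list of its ℓ classes
-- (order of the list is irrelevant; sets are compared up to permutation).
IsSubpartition : ℕ → ℕ → (n : ℕ) → List (Subset n) → Set
IsSubpartition k ℓ n P =
  (length P ≡ ℓ) × All (λ A → ∣ A ∣ ≡ k) P × AllPairs (λ A B → A ≢ B × Disjoint A B) P

TIntersecting : ℕ → ∀ {n} → List (Subset n) → List (Subset n) → Set
TIntersecting t {n} P Q =
  ∃[ T ] (length T ≡ t × AllPairs _≢_ T × T ⊆ P × T ⊆ Q)

-- A t-intersecting family of (k,ℓ)-subpartitions of [n], given as a list of
-- pairwise distinct subpartitions (distinct as sets, i.e. not permutations
-- of each other), so that its cardinality is the length of the list.
IntersectingFamily : ℕ → ℕ → ℕ → (n : ℕ) → List (List (Subset n)) → Set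
IntersectingFamily k ℓ t n 𝒫 =
  All (IsSubpartition k ℓ n) 𝒫 ×
  AllPairs (λ P Q → ¬ (P ↭ Q)) 𝒫 ×
  AllPairs (TIntersecting t) 𝒫

Canonical : ℕ → ℕ → ℕ → (n : ℕ) → List (List (Subset n)) → Set
Canonical k ℓ t n 𝒫 =
  ∃[ T ] (length T ≡ t × All (λ A → ∣ A ∣ ≡ k) T ×
          AllPairs (λ A B → A ≢ B × Disjoint A B) T ×
          (∀ P → IsSubpartition k ℓ n P → (T ⊆ P ⇔ Any (λ Q → P ↭ Q) 𝒫)))

bound : ℕ → ℕ → ℕ → ℕ → ℕ
bound n k ℓ t = product (map (λ i → (n ∸ i * k) C k) (drop t (upTo ℓ)))

{-# OPTIONS --safe #-}
module Submission where

-- Regard the k-subsets of [n] as points, so that a subpartition is a set of ℓ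
-- points.  At most bound n k ℓ s / (ℓ ∸ s)! subpartitions contain s given
-- points: count the pairs (P , A) where A is a class of P other than these.
-- This settles families all of whose members share t points; a family
-- attaining the bound is then complete, since otherwise adding a missing
-- subpartition would violate it.
-- If no t points are common to all members, then for every set T of at most t
-- points some member R is such that each member containing T also contains a
-- point of R outside T.  Branching over the ℓ points of R, suc t times and
-- starting from T = ∅, distributes the family over ℓ ^ suc t sets of suc t
-- points, which bounds its size by a constant times bound n k ℓ (suc t); this
-- is smaller than the canonical size by a factor of order (n ∸ t * k) C k.

open import Defs
open import Data.Bool.Properties using () renaming (_≟_ to _≟ᵇ_)
open import Data.Fin.Subset using (Subset; inside; outside; ∣_∣; _∩_; _∪_; ⊥; ⋃)
open import Data.Fin.Subset.Properties using (∣p∣≤n; ∣⊥∣≡0; ∩-comm; ∩-zeroʳ; ∩-distribˡ-∪; ∪-identityˡ)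
open import Data.List using (List; []; _∷_; _++_; [_]; length; map; filter; take; drop; applyUpTo; upTo)
open import Data.List.Membership.Propositional using (_∈_; _∉_; find; lose)
open import Data.List.Membership.Propositional.Properties using (∈-∃++; ∈-++⁺ˡ; ∈-++⁺ʳ; ∈-map⁺; ∈-filter⁺; ∈-filter⁻)
open import Data.List.Properties using (length-++; length-map; length-filter; length-take; length-upTo; drop-all; filter-some)
open import Data.List.Relation.Binary.Permutation.Propositional using (_↭_; ↭-refl; ↭-sym; ↭-trans; prep)
open import Data.List.Relation.Binary.Permutation.Propositional.Properties using (∈-resp-↭; shift; ↭-length)
open import Data.List.Relation.Binary.Subset.Propositional using (_⊆_)
open import Data.List.Relation.Binary.Subset.Propositional.Properties using (filter-⊆)
open import Data.List.Relation.Unary.All as All using (All; []; _∷_)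
open import Data.List.Relation.Unary.All.Properties as All using (¬All⇒Any¬)
open import Data.List.Relation.Unary.AllPairs as AllPairs using (AllPairs; []; _∷_)
open import Data.List.Relation.Unary.AllPairs.Properties as AllPairs using ()
open import Data.List.Relation.Unary.Any using (Any; here; there; any?)
open import Data.List.Relation.Unary.Any.Properties using (¬Any[])
open import Data.List.Relation.Unary.Unique.Propositional using (Unique)
open import Data.Nat using (ℕ; zero; suc; _+_; _≤_; _<_; _∸_; _*_; _^_; _!; z≤n; s≤s; s≤s⁻¹; >-nonZero)
open import Data.Nat.Combinatorics using (_C_; nCn≡1; nCk+nC[k+1]≡[n+1]C[k+1])
open import Data.Nat.ListAction using (sum; product)
open import Data.Nat.Properties
open import Data.Nat.Tactic.RingSolver using (solve-∀)
open import Data.Product using (_×_; ∃-syntax; _,_; proj₁; proj₂)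
open import Data.Sum using (_⊎_; inj₁; inj₂; [_,_]′)
open import Data.Vec using ([]; _∷_)
open import Data.Vec.Properties using (≡-dec; ∷-injectiveʳ)
open import Function using (_∘_; id; mk⇔)
open import Relation.Binary.Definitions using (DecidableEquality; Symmetric)
open import Relation.Binary.PropositionalEquality using (_≡_; _≢_; refl; sym; trans; cong; cong₂; subst; module ≡-Reasoning)
open import Relation.Nullary using (¬_; Dec; yes; no; contradiction)

-- Finite lists

module _ {A : Set} where

  AllPairs-lookup : ∀ {R : A → A → Set} {xs} → Symmetric R → AllPairs R xs →
                    ∀ {x y} → x ∈ xs → y ∈ xs → x ≡ y ⊎ R x y
  AllPairs-lookup R-sym (_ ∷ _)     (here refl) (here refl) = inj₁ refl
  AllPairs-lookup R-sym (Rx ∷ _)    (here refl) (there y∈)  = inj₂ (All.lookup Rx y∈)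
  AllPairs-lookup R-sym (Ry ∷ _)    (there x∈)  (here refl) = inj₂ (R-sym (All.lookup Ry x∈))
  AllPairs-lookup R-sym (_ ∷ pairs) (there x∈)  (there y∈)  = AllPairs-lookup R-sym pairs x∈ y∈

  -- Serves the branching argument: one branch that finds common classes settles everything, and
  -- otherwise the bounds of all branches are available together.
  All-⊎ : ∀ {X : Set} {Y : A → Set} {xs} → All (λ x → X ⊎ Y x) xs → X ⊎ All Y xs
  All-⊎ []              = inj₂ []
  All-⊎ (inj₁ x ∷ _)    = inj₁ x
  All-⊎ (inj₂ y ∷ rest) = [ inj₁ , (λ ys → inj₂ (y ∷ ys)) ]′ (All-⊎ rest)

  Unique-⊆-uncons : ∀ {x : A} {xs ys} → Unique (x ∷ xs) → x ∷ xs ⊆ ys →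
                    ∃[ zs ] (ys ↭ x ∷ zs × xs ⊆ zs)
  Unique-⊆-uncons {x} {xs} (x∉xs ∷ _) x∷xs⊆ys with ∈-∃++ (x∷xs⊆ys (here refl))
  ... | as , bs , refl = as ++ bs , shift x as bs , λ z∈xs →
        strip z∈xs (∈-resp-↭ (shift x as bs) (x∷xs⊆ys (there z∈xs)))
    where
    strip : ∀ {z} → z ∈ xs → z ∈ x ∷ as ++ bs → z ∈ as ++ bs
    strip z∈xs (here refl) = contradiction refl (All.lookup x∉xs z∈xs)
    strip _    (there z∈)  = z∈

  Unique-⊆⇒length≤ : ∀ {xs ys : List A} → Unique xs → xs ⊆ ys → length xs ≤ length ys
  Unique-⊆⇒length≤ {[]}     _            _     = z≤n
  Unique-⊆⇒length≤ {x ∷ xs} uxs@(_ ∷ us) xs⊆ys with Unique-⊆-uncons uxs xs⊆ys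
  ... | zs , ys↭ , xs⊆zs = ≤-trans (s≤s (Unique-⊆⇒length≤ us xs⊆zs)) (≤-reflexive (sym (↭-length ys↭)))

  Unique-⊆⇒↭ : ∀ {xs ys : List A} → Unique xs → xs ⊆ ys → length ys ≤ length xs → xs ↭ ys
  Unique-⊆⇒↭ {[]}     {[]} _            _     _   = ↭-refl
  Unique-⊆⇒↭ {x ∷ xs}      uxs@(_ ∷ us) xs⊆ys len with Unique-⊆-uncons uxs xs⊆ys
  ... | zs , ys↭ , xs⊆zs = ↭-trans (prep x (Unique-⊆⇒↭ us xs⊆zs len′)) (↭-sym ys↭)
    where
    len′ : length zs ≤ length xs
    len′ = s≤s⁻¹ (≤-trans (≤-reflexive (sym (↭-length ys↭))) len)

-- Double counting

m+[n+o]≡n+[m+o] : ∀ a b c → a + (b + c) ≡ b + (a + c)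
m+[n+o]≡n+[m+o] = solve-∀

module DoubleCounting {A B : Set} {R : A → B → Set} (R? : ∀ x y → Dec (R x y)) where

  degree : List A → B → ℕ
  degree xs y = length (filter (λ x → R? x y) xs)

  sum-degree-∷ : ∀ x xs ys → sum (map (degree (x ∷ xs)) ys) ≡
                             length (filter (R? x) ys) + sum (map (degree xs) ys)
  sum-degree-∷ x xs []       = refl
  sum-degree-∷ x xs (y ∷ ys) with R? x y
  ... | yes _ = cong suc (trans (cong (degree xs y +_) (sum-degree-∷ x xs ys))
                                (m+[n+o]≡n+[m+o] (degree xs y) (length (filter (R? x) ys)) _))
  ... | no _  = trans (cong (degree xs y +_) (sum-degree-∷ x xs ys))
                      (m+[n+o]≡n+[m+o] (degree xs y) (length (filter (R? x) ys)) _)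

  sum-degree-lower : ∀ {m} xs ys → All (λ y → m ≤ degree xs y) ys →
                     length ys * m ≤ sum (map (degree xs) ys)
  sum-degree-lower xs []       []           = z≤n
  sum-degree-lower xs (y ∷ ys) (m≤ ∷ rest) = +-mono-≤ m≤ (sum-degree-lower xs ys rest)

  sum-degree-upper : ∀ {w c} xs ys → All (λ x → length (filter (R? x) ys) * w ≤ c) xs →
                     sum (map (degree xs) ys) * w ≤ length xs * c
  sum-degree-upper {w} [] ys [] = ≤-reflexive (cong (_* w) (zeros ys))
    where
    zeros : ∀ ys → sum (map (degree []) ys) ≡ 0
    zeros []       = refl
    zeros (_ ∷ ys) = zeros ys
  sum-degree-upper {w} {c} (x ∷ xs) ys (≤c ∷ rest) = begin
    sum (map (degree (x ∷ xs)) ys) * w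
      ≡⟨ cong (_* w) (sum-degree-∷ x xs ys) ⟩
    (length (filter (R? x) ys) + sum (map (degree xs) ys)) * w
      ≡⟨ *-distribʳ-+ w (length (filter (R? x) ys)) _ ⟩
    length (filter (R? x) ys) * w + sum (map (degree xs) ys) * w
      ≤⟨ +-mono-≤ ≤c (sum-degree-upper xs ys rest) ⟩
    c + length xs * c ∎
    where open ≤-Reasoning

  -- The related pairs are summed over `ys` and then over `xs`. The weight `w` lets upper bounds of
  -- the form "size times a factorial" enter without division.
  double-counting : ∀ {m w c} xs ys → All (λ y → m ≤ degree xs y) ys →
                    All (λ x → length (filter (R? x) ys) * w ≤ c) xs →
                    length ys * (m * w) ≤ length xs * c
  double-counting {m} {w} {c} xs ys lower upper = begin
    length ys * (m * w)          ≡⟨ *-assoc (length ys) m w ⟨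
    length ys * m * w            ≤⟨ *-monoˡ-≤ w (sum-degree-lower xs ys lower) ⟩
    sum (map (degree xs) ys) * w ≤⟨ sum-degree-upper xs ys upper ⟩
    length xs * c                ∎
    where open ≤-Reasoning

-- Subsets of [n]

infix 4 _≟ˢ_ _∈ˡ?_ _∉ˡ?_ _⊆ˡ?_

_≟ˢ_ : ∀ {n} → DecidableEquality (Subset n)
_≟ˢ_ = ≡-dec _≟ᵇ_

_∈ˡ?_ : ∀ {n} (A : Subset n) (P : List (Subset n)) → Dec (A ∈ P)
A ∈ˡ? P = any? (A ≟ˢ_) P

_∉ˡ?_ : ∀ {n} (A : Subset n) (P : List (Subset n)) → Dec (A ∉ P)
_∉ˡ?_ = _∉?_
  where open import Data.List.Membership.DecPropositional _≟ˢ_ using (_∉?_)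

_⊆ˡ?_ : ∀ {n} (T P : List (Subset n)) → Dec (T ⊆ P)
_⊆ˡ?_ = _⊆?_
  where open import Data.List.Relation.Binary.Subset.DecPropositional _≟ˢ_ using (_⊆?_)

Disjoint-sym : ∀ {n} {A B : Subset n} → Disjoint A B → Disjoint B A
Disjoint-sym {A = A} {B} A∩B≡⊥ = trans (∩-comm B A) A∩B≡⊥

∣p∪q∣≡∣p∣+∣q∣ : ∀ {n} (p q : Subset n) → Disjoint p q → ∣ p ∪ q ∣ ≡ ∣ p ∣ + ∣ q ∣
∣p∪q∣≡∣p∣+∣q∣ []            []            _   = refl
∣p∪q∣≡∣p∣+∣q∣ (inside ∷ p)  (outside ∷ q) dis = cong suc (∣p∪q∣≡∣p∣+∣q∣ p q (∷-injectiveʳ dis))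
∣p∪q∣≡∣p∣+∣q∣ (outside ∷ p) (inside ∷ q)  dis =
  trans (cong suc (∣p∪q∣≡∣p∣+∣q∣ p q (∷-injectiveʳ dis))) (sym (+-suc ∣ p ∣ ∣ q ∣))
∣p∪q∣≡∣p∣+∣q∣ (outside ∷ p) (outside ∷ q) dis = ∣p∪q∣≡∣p∣+∣q∣ p q (∷-injectiveʳ dis)

Disjoint-⋃ : ∀ {n} {A : Subset n} {T} → All (Disjoint A) T → Disjoint A (⋃ T)
Disjoint-⋃ {A = A} {[]}    []           = ∩-zeroʳ A
Disjoint-⋃ {A = A} {B ∷ T} (dis ∷ rest) = begin
  A ∩ (B ∪ ⋃ T)       ≡⟨ ∩-distribˡ-∪ A B (⋃ T) ⟩
  (A ∩ B) ∪ (A ∩ ⋃ T) ≡⟨ cong₂ _∪_ dis (Disjoint-⋃ rest) ⟩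
  ⊥ ∪ ⊥               ≡⟨ ∪-identityˡ ⊥ ⟩
  ⊥                   ∎
  where open ≡-Reasoning

∣⋃∣ : ∀ {n k} {T : List (Subset n)} → All (λ A → ∣ A ∣ ≡ k) T → AllPairs Disjoint T →
      ∣ ⋃ T ∣ ≡ length T * k
∣⋃∣ {n}         []           []           = ∣⊥∣≡0 n
∣⋃∣ {T = A ∷ T} (size ∷ sizes) (dis ∷ diss) =
  trans (∣p∪q∣≡∣p∣+∣q∣ A (⋃ T) (Disjoint-⋃ dis)) (cong₂ _+_ size (∣⋃∣ sizes diss))

-- The recursion branches exactly where Pascal's rule does, at elements outside `U`, so the length
-- of the list is a binomial coefficient by induction.
kSubsetsAvoiding : ∀ {n} → Subset n → ℕ → List (Subset n)
kSubsetsAvoiding []            zero    = [ [] ]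
kSubsetsAvoiding []            (suc k) = []
kSubsetsAvoiding (inside ∷ U)  k       = map (outside ∷_) (kSubsetsAvoiding U k)
kSubsetsAvoiding (outside ∷ U) zero    = map (outside ∷_) (kSubsetsAvoiding U zero)
kSubsetsAvoiding (outside ∷ U) (suc k) =
  map (inside ∷_) (kSubsetsAvoiding U k) ++ map (outside ∷_) (kSubsetsAvoiding U (suc k))

∈-kSubsetsAvoiding : ∀ {n} (A U : Subset n) → Disjoint A U → A ∈ kSubsetsAvoiding U ∣ A ∣
∈-kSubsetsAvoiding []            []            _   = here refl
∈-kSubsetsAvoiding (outside ∷ A) (inside ∷ U)  dis =
  ∈-map⁺ (outside ∷_) (∈-kSubsetsAvoiding A U (∷-injectiveʳ dis))
∈-kSubsetsAvoiding (inside ∷ A)  (outside ∷ U) dis =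
  ∈-++⁺ˡ (∈-map⁺ (inside ∷_) (∈-kSubsetsAvoiding A U (∷-injectiveʳ dis)))
∈-kSubsetsAvoiding (outside ∷ A) (outside ∷ U) dis
  with ∣ A ∣ | ∈-kSubsetsAvoiding A U (∷-injectiveʳ dis)
... | zero  | A∈ = ∈-map⁺ (outside ∷_) A∈
... | suc k | A∈ = ∈-++⁺ʳ (map (inside ∷_) (kSubsetsAvoiding U k)) (∈-map⁺ (outside ∷_) A∈)

length-kSubsetsAvoiding : ∀ {n} (U : Subset n) k → length (kSubsetsAvoiding U k) ≡ (n ∸ ∣ U ∣) C k
length-kSubsetsAvoiding []            zero    = refl
length-kSubsetsAvoiding []            (suc k) = refl
length-kSubsetsAvoiding (inside ∷ U)  k       =
  trans (length-map (outside ∷_) (kSubsetsAvoiding U k)) (length-kSubsetsAvoiding U k)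
length-kSubsetsAvoiding (outside ∷ U) zero    =
  trans (length-map (outside ∷_) (kSubsetsAvoiding U zero)) (length-kSubsetsAvoiding U zero)
length-kSubsetsAvoiding {suc n} (outside ∷ U) (suc k) = begin
  length (map (inside ∷_) (kSubsetsAvoiding U k) ++ map (outside ∷_) (kSubsetsAvoiding U (suc k)))
    ≡⟨ length-++ (map (inside ∷_) (kSubsetsAvoiding U k)) ⟩
  length (map (inside ∷_) (kSubsetsAvoiding U k)) + length (map (outside ∷_) (kSubsetsAvoiding U (suc k)))
    ≡⟨ cong₂ _+_ (trans (length-map _ (kSubsetsAvoiding U k)) (length-kSubsetsAvoiding U k))
                 (trans (length-map _ (kSubsetsAvoiding U (suc k))) (length-kSubsetsAvoiding U (suc k))) ⟩
  (n ∸ ∣ U ∣) C k + (n ∸ ∣ U ∣) C suc k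
    ≡⟨ nCk+nC[k+1]≡[n+1]C[k+1] (n ∸ ∣ U ∣) k ⟩
  suc (n ∸ ∣ U ∣) C suc k
    ≡⟨ cong (_C suc k) (+-∸-assoc 1 (∣p∣≤n U)) ⟨
  (suc n ∸ ∣ U ∣) C suc k ∎
  where open ≡-Reasoning

-- The numerical bound

-- Stated for arbitrary `f` because the induction replaces `f` by `f ∘ suc`. The case `f = id`
-- splits the factor with index `s` off the product in `bound`.
drop-applyUpTo : ∀ {A : Set} (f : ℕ → A) s d →
                 drop s (applyUpTo f (s + suc d)) ≡ f s ∷ drop (suc s) (applyUpTo f (s + suc d))
drop-applyUpTo f zero    d = refl
drop-applyUpTo f (suc s) d = drop-applyUpTo (f ∘ suc) s d

bound-full : ∀ n k ℓ → bound n k ℓ ℓ ≡ 1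
bound-full n k ℓ = cong (λ is → product (map (λ i → (n ∸ i * k) C k) is))
                        (drop-all ℓ (upTo ℓ) (≤-reflexive (length-upTo ℓ)))

bound-step : ∀ n k {ℓ} s d → s + suc d ≡ ℓ →
             bound n k ℓ s ≡ ((n ∸ s * k) C k) * bound n k ℓ (suc s)
bound-step n k s d refl = cong (λ is → product (map (λ i → (n ∸ i * k) C k) is)) (drop-applyUpTo id s d)

-- Each increment of `d` adds, by Pascal's rule, a term that is at least 1. This linear growth is
-- enough to beat any constant.
d<[k+d]Ck : ∀ k d → 1 ≤ k → d < (k + d) C k
d<[k+d]Ck (suc k) zero    _ rewrite +-identityʳ k = ≤-reflexive (sym (nCn≡1 (suc k)))
d<[k+d]Ck (suc k) (suc d) _ = begin
  1 + suc d                              ≤⟨ +-mono-≤ (positive k) (d<[k+d]Ck (suc k) d (s≤s z≤n)) ⟩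
  (k + suc d) C k + (suc k + d) C suc k  ≡⟨ cong (λ m → (k + suc d) C k + m C suc k) (+-suc k d) ⟨
  (k + suc d) C k + (k + suc d) C suc k  ≡⟨ nCk+nC[k+1]≡[n+1]C[k+1] (k + suc d) k ⟩
  (suc k + suc d) C suc k                ∎
  where
  open ≤-Reasoning
  positive : ∀ k → 1 ≤ (k + suc d) C k
  positive zero    = ≤-refl
  positive (suc k) = ≤-trans (s≤s z≤n) (d<[k+d]Ck (suc k) (suc d) (s≤s z≤n))

d<mCk : ∀ {k d m} → 1 ≤ k → k + d ≤ m → d < m C k
d<mCk {k} {d} {m} 1≤k k+d≤m =
  ≤-trans (s≤s (m≤m+n d (m ∸ (k + d))))
          (subst (λ x → d + (m ∸ (k + d)) < x C k)
                 (trans (sym (+-assoc k d _)) (m+[n∸m]≡n k+d≤m))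
                 (d<[k+d]Ck k (d + (m ∸ (k + d))) 1≤k))

d<[n∸sk]Ck : ∀ {n k s ℓ} d → 1 ≤ k → s < ℓ → ℓ * k + d ≤ n → d < (n ∸ s * k) C k
d<[n∸sk]Ck {n} {k} {s} {ℓ} d 1≤k s<ℓ ℓk+d≤n = d<mCk 1≤k (m+n≤o⇒m≤o∸n (k + d) (begin
  k + d + s * k   ≡⟨ rearrange k d (s * k) ⟩
  suc s * k + d   ≤⟨ +-monoˡ-≤ d (*-monoˡ-≤ k s<ℓ) ⟩
  ℓ * k + d       ≤⟨ ℓk+d≤n ⟩
  n               ∎))
  where
  open ≤-Reasoning
  rearrange : ∀ a b c → a + b + c ≡ a + c + b
  rearrange = solve-∀

-- Keeps an inequality strict after multiplication by `bound`, and prevents the empty family from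
-- attaining the bound.
bound-positive : ∀ {n k ℓ} s d → 1 ≤ k → ℓ * k ≤ n → s + d ≡ ℓ → 0 < bound n k ℓ s
bound-positive {n} {k} s zero    1≤k ℓk≤n refl rewrite +-identityʳ s | bound-full n k s = s≤s z≤n
bound-positive {n} {k} {ℓ} s (suc d) 1≤k ℓk≤n eq rewrite bound-step n k s d eq =
  *-mono-≤ (d<[n∸sk]Ck 0 1≤k s<ℓ (≤-trans (≤-reflexive (+-identityʳ _)) ℓk≤n))
           (bound-positive (suc s) d 1≤k ℓk≤n (trans (sym (+-suc s d)) eq))
  where
  s<ℓ : s < ℓ
  s<ℓ = subst (s <_) eq (m<m+n s (s≤s z≤n))

-- Subpartitions containing a given set of classes

IsSubpartition⇒Unique : ∀ {k ℓ n P} → IsSubpartition k ℓ n P → Unique P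
IsSubpartition⇒Unique (_ , _ , pairs) = AllPairs.map proj₁ pairs

classes-disjoint : ∀ {k ℓ n P} → IsSubpartition k ℓ n P →
                   ∀ {A B} → A ∈ P → B ∈ P → A ≢ B → Disjoint A B
classes-disjoint (_ , _ , pairs) {A} {B} A∈P B∈P A≢B =
  [ (λ A≡B → contradiction A≡B A≢B) , id ]′
    (AllPairs-lookup (λ {A} {B} → Disjoint-sym {A = A} {B}) (AllPairs.map proj₂ pairs) A∈P B∈P)

classes-AllPairs : ∀ {k ℓ n P} {T : List (Subset n)} → IsSubpartition k ℓ n P → Unique T → T ⊆ P →
                   AllPairs (λ A B → A ≢ B × Disjoint A B) T
classes-AllPairs subP []         _   = []
classes-AllPairs {T = A ∷ T} subP (A∉T ∷ uT) T⊆P =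
  All.tabulate (λ B∈T → All.lookup A∉T B∈T ,
    classes-disjoint subP (T⊆P (here refl)) (T⊆P (there B∈T)) (All.lookup A∉T B∈T))
  ∷ classes-AllPairs subP uT (T⊆P ∘ there)

classes-size : ∀ {k ℓ n P} {T : List (Subset n)} → IsSubpartition k ℓ n P → T ⊆ P →
               All (λ A → ∣ A ∣ ≡ k) T
classes-size (_ , sizes , _) T⊆P = All.tabulate (λ A∈T → All.lookup sizes (T⊆P A∈T))

-- In contrast to `Canonical`, `𝒢` may be only a part of the subpartitions containing `T`.
Star : ∀ k ℓ {n} → List (Subset n) → List (List (Subset n)) → Set
Star k ℓ {n} T 𝒢 = All (IsSubpartition k ℓ n) 𝒢 × AllPairs (λ P Q → ¬ (P ↭ Q)) 𝒢 × All (T ⊆_) 𝒢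

Star-filter : ∀ {k ℓ n T 𝒢} (A : Subset n) → Star k ℓ T 𝒢 → Star k ℓ (A ∷ T) (filter (A ∈ˡ?_) 𝒢)
Star-filter {T = T} {𝒢} A (subs , distinct , T⊆) =
  All.filter⁺ (A ∈ˡ?_) subs , AllPairs.filter⁺ (A ∈ˡ?_) distinct ,
  All.tabulate (λ P∈ → let (P∈𝒢 , A∈P) = ∈-filter⁻ (A ∈ˡ?_) {xs = 𝒢} P∈ in cons A∈P (All.lookup T⊆ P∈𝒢))
  where
  cons : ∀ {P} → A ∈ P → T ⊆ P → A ∷ T ⊆ P
  cons A∈P T⊆P (here refl) = A∈P
  cons A∈P T⊆P (there B∈T) = T⊆P B∈T

-- The candidates for a further class beside those of `T`. The filter secures `A ∉ T` also for
-- `k = 0`, where the empty set is disjoint from itself.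
extensions : ∀ {n} → ℕ → List (Subset n) → List (Subset n)
extensions k T = filter (_∉ˡ? T) (kSubsetsAvoiding (⋃ T) k)

-- Lying inside a subpartition makes the members of `T` disjoint `k`-sets, so their union has
-- exactly `length T * k` elements.
length-extensions : ∀ {k ℓ n P} {T : List (Subset n)} → IsSubpartition k ℓ n P → Unique T → T ⊆ P →
                    length (extensions k T) ≤ (n ∸ length T * k) C k
length-extensions {k} {n = n} {T = T} subP uT T⊆P = begin
  length (extensions k T)             ≤⟨ length-filter (_∉ˡ? T) (kSubsetsAvoiding (⋃ T) k) ⟩
  length (kSubsetsAvoiding (⋃ T) k)   ≡⟨ length-kSubsetsAvoiding (⋃ T) k ⟩
  (n ∸ ∣ ⋃ T ∣) C k                   ≡⟨ cong (λ u → (n ∸ u) C k) (∣⋃∣ (classes-size subP T⊆P)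
                                           (AllPairs.map proj₂ (classes-AllPairs subP uT T⊆P))) ⟩
  (n ∸ length T * k) C k              ∎
  where open ≤-Reasoning

class∈extensions : ∀ {k ℓ n P} {T : List (Subset n)} {A} → IsSubpartition k ℓ n P → T ⊆ P →
                   A ∈ P → A ∉ T → A ∈ extensions k T
class∈extensions {T = T} {A} subP@(_ , sizes , _) T⊆P A∈P A∉T = ∈-filter⁺ (_∉ˡ? T)
  (subst (λ j → A ∈ kSubsetsAvoiding (⋃ T) j) (All.lookup sizes A∈P)
    (∈-kSubsetsAvoiding A (⋃ T) (Disjoint-⋃ (All.tabulate λ B∈T →
      classes-disjoint subP A∈P (T⊆P B∈T) λ { refl → A∉T B∈T }))))
  A∉T

-- The `ℓ` distinct classes of `P` all occur in `T` or among the extensions; comparing lengths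
-- leaves at least `d` for the latter.
extensions-in-subpartition : ∀ {k ℓ n d P} {T : List (Subset n)} → length T + d ≡ ℓ →
  IsSubpartition k ℓ n P → T ⊆ P → d ≤ length (filter (_∈ˡ? P) (extensions k T))
extensions-in-subpartition {k} {ℓ} {d = d} {P} {T} eq subP T⊆P = +-cancelˡ-≤ (length T) _ _ (begin
  length T + d
    ≡⟨ trans eq (sym (proj₁ subP)) ⟩
  length P
    ≤⟨ Unique-⊆⇒length≤ (IsSubpartition⇒Unique subP) split ⟩
  length (T ++ filter (_∈ˡ? P) (extensions k T))
    ≡⟨ length-++ T ⟩
  length T + length (filter (_∈ˡ? P) (extensions k T)) ∎)
  where
  open ≤-Reasoning
  split : P ⊆ T ++ filter (_∈ˡ? P) (extensions k T)
  split {A} A∈P with A ∈ˡ? T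
  ... | yes A∈T = ∈-++⁺ˡ A∈T
  ... | no  A∉T = ∈-++⁺ʳ T (∈-filter⁺ (_∈ˡ? P) (class∈extensions subP T⊆P A∈P A∉T) A∈P)

-- Induction on the number `d` of free classes. For `suc d`, every member contains at least `suc d`
-- extensions of `T`, and for each extension `A` the members containing `A` form a star over
-- `A ∷ T`, to which the case `d` applies.
star-bound : ∀ {k ℓ n} d {T : List (Subset n)} {𝒢} → Unique T → length T + d ≡ ℓ → Star k ℓ T 𝒢 →
             length 𝒢 * d ! ≤ bound n k ℓ (length T)
star-bound d {𝒢 = []} _ _ _ = z≤n
star-bound {k} {n = n} zero {T} {P ∷ []} uT refl _ rewrite +-identityʳ (length T) =
  ≤-reflexive (sym (bound-full n k (length T)))
-- With no free class every member is a permutation of `T`, so two distinct members cannot exist.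
star-bound zero {T} {P ∷ Q ∷ 𝒢} uT eq
  ((subP ∷ subQ ∷ _) , ((P≁Q ∷ _) ∷ _) , (T⊆P ∷ T⊆Q ∷ _)) =
  contradiction (↭-trans (↭-sym (T↭ subP T⊆P)) (T↭ subQ T⊆Q)) P≁Q
  where
  T↭ : ∀ {P} → IsSubpartition _ _ _ P → T ⊆ P → T ↭ P
  T↭ (len , _) T⊆P = Unique-⊆⇒↭ uT T⊆P
    (≤-reflexive (trans len (trans (sym eq) (+-identityʳ (length T)))))
star-bound {k} {ℓ} {n} (suc d) {T} {𝒢@(P ∷ _)} uT eq star@(subs@(subP ∷ _) , _ , T⊆@(T⊆P ∷ _)) = begin
  length 𝒢 * (suc d * d !)
    ≤⟨ double-counting (extensions k T) 𝒢
         (All.tabulate λ Q∈ → extensions-in-subpartition eq (All.lookup subs Q∈) (All.lookup T⊆ Q∈))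
         (All.tabulate λ {A} A∈ → star-bound d
           (All.tabulate (λ { B∈T refl → proj₂ (∈-filter⁻ (_∉ˡ? T) {xs = kSubsetsAvoiding (⋃ T) k} A∈) B∈T }) ∷ uT)
           (trans (sym (+-suc (length T) d)) eq) (Star-filter A star)) ⟩
  length (extensions k T) * bound n k ℓ (suc (length T))
    ≤⟨ *-monoˡ-≤ _ (length-extensions subP uT T⊆P) ⟩
  ((n ∸ length T * k) C k) * bound n k ℓ (suc (length T))
    ≡⟨ bound-step n k (length T) d eq ⟨
  bound n k ℓ (length T) ∎
  where
  open ≤-Reasoning
  open DoubleCounting (_∈ˡ?_ {n}) using (double-counting)

star-complete : ∀ {k ℓ n} d {T : List (Subset n)} {𝒢} → Unique T → length T + d ≡ ℓ → Star k ℓ T 𝒢 →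
                length 𝒢 * d ! ≡ bound n k ℓ (length T) →
                ∀ P → IsSubpartition k ℓ n P → T ⊆ P → Any (P ↭_) 𝒢
-- The case split tests inclusion, which is decidable; between lists of `ℓ` distinct classes
-- inclusion already gives a permutation.
star-complete {k} {ℓ} {n} d {T} {𝒢} uT eq (subs , distinct , T⊆) tight P subP T⊆P
  with any? (P ⊆ˡ?_) 𝒢
... | yes P⊆Q = let (Q , Q∈𝒢 , P⊆Q) = find P⊆Q in
  lose Q∈𝒢 (Unique-⊆⇒↭ (IsSubpartition⇒Unique subP) P⊆Q
    (≤-reflexive (trans (proj₁ (All.lookup subs Q∈𝒢)) (sym (proj₁ subP)))))
... | no P⊈ = contradiction overfull (<⇒≱ (m<n+m (length 𝒢 * d !) (n!>0 d)))
  where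
  n!>0 : ∀ n → 0 < n !
  n!>0 zero    = s≤s z≤n
  n!>0 (suc n) = *-mono-≤ (s≤s (z≤n {n})) (n!>0 n)
  overfull : length (P ∷ 𝒢) * d ! ≤ length 𝒢 * d !
  overfull = ≤-trans
    (star-bound d uT eq (subP ∷ subs ,
      All.tabulate (λ Q∈𝒢 P↭Q → P⊈ (lose Q∈𝒢 (∈-resp-↭ P↭Q))) ∷ distinct , T⊆P ∷ T⊆))
    (≤-reflexive (sym tight))

-- Families without t common classes

TIntersecting-sym : ∀ {t n} {P Q : List (Subset n)} → TIntersecting t P Q → TIntersecting t Q P
TIntersecting-sym (T , len , uT , T⊆P , T⊆Q) = T , len , uT , T⊆Q , T⊆P

-- `AllPairs` compares only different positions of the family, while the branching also compares the
-- member `R` with itself.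
TIntersecting-self : ∀ {t k ℓ n} {P : List (Subset n)} → t ≤ ℓ → IsSubpartition k ℓ n P →
                     TIntersecting t P P
TIntersecting-self {t} {P = P} t≤ℓ subP@(len , _) =
  take t P , trans (length-take t P) (m≤n⇒m⊓n≡m (≤-trans t≤ℓ (≤-reflexive (sym len)))) ,
  AllPairs.take⁺ t (IsSubpartition⇒Unique subP) , take⊆ , take⊆
  where
  take⊆ : take t P ⊆ P
  take⊆ = All.lookup (All.take⁺ t (All.tabulate id))

TIntersecting-lookup : ∀ {k ℓ t n 𝒫} → t ≤ ℓ → IntersectingFamily k ℓ t n 𝒫 →
                       ∀ {P Q} → P ∈ 𝒫 → Q ∈ 𝒫 → TIntersecting t P Q
TIntersecting-lookup t≤ℓ (subs , _ , meets) P∈ Q∈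
  with AllPairs-lookup TIntersecting-sym meets P∈ Q∈
... | inj₁ refl = TIntersecting-self t≤ℓ (All.lookup subs P∈)
... | inj₂ meet = meet

-- T ⊈ R together with |T| = t has the same effect as |T| < t: the t common
-- classes of Q and R cannot all lie in T.
common-class-outside : ∀ {t n} {T Q R : List (Subset n)} → length T ≤ t → length T < t ⊎ ¬ (T ⊆ R) →
                       TIntersecting t Q R → ∃[ A ] (A ∈ Q × A ∈ R × A ∉ T)
common-class-outside {t} {T = T} {R = R} T≤t small (S , len , uS , S⊆Q , S⊆R) with any? (_∉ˡ? T) S
... | yes outsider = let (A , A∈S , A∉T) = find outsider in A , S⊆Q A∈S , S⊆R A∈S , A∉T
... | no none = contradiction small [ T≮t , ¬T⊈R ]′
  where
  S⊆T : S ⊆ T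
  S⊆T {A} A∈S with A ∈ˡ? T
  ... | yes A∈T = A∈T
  ... | no  A∉T = contradiction (lose A∈S A∉T) none
  T≮t : ¬ (length T < t)
  T≮t T<t = <⇒≱ T<t (≤-trans (≤-reflexive (sym len)) (Unique-⊆⇒length≤ uS S⊆T))
  ¬T⊈R : ¬ ¬ (T ⊆ R)
  ¬T⊈R T⊈R = T⊈R (S⊆R ∘ ∈-resp-↭ (↭-sym (Unique-⊆⇒↭ uS S⊆T (≤-trans T≤t (≤-reflexive (sym len))))))

CommonClasses : ∀ {n} → ℕ → List (List (Subset n)) → Set
CommonClasses t 𝒫 = ∃[ T ] (Unique T × length T ≡ t × All (T ⊆_) 𝒫)

module Branching {k ℓ t m n} (t+1+m≡ℓ : suc t + m ≡ ℓ) {𝒫 : List (List (Subset n))}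
                 (family : IntersectingFamily k ℓ t n 𝒫) where

  t≤ℓ : t ≤ ℓ
  t≤ℓ = ≤-trans (m≤n⇒m≤1+n (m≤m+n t m)) (≤-reflexive t+1+m≡ℓ)

  -- A member not containing `T` serves as `R`. If there is none, then `T` itself is common to all:
  -- this is the first outcome when `d` is zero, and for larger `d` any member serves.
  splitting-member : ∀ d (T : List (Subset n)) → Unique T → length T + d ≡ t →
    CommonClasses t 𝒫 ⊎ (𝒫 ≡ [] ⊎ ∃[ R ] (R ∈ 𝒫 × (length T < t ⊎ ¬ (T ⊆ R))))
  splitting-member d T uT eq with All.all? (T ⊆ˡ?_) 𝒫
  splitting-member d       T uT eq | no ¬all =
    let (R , R∈𝒫 , T⊈R) = find (¬All⇒Any¬ (T ⊆ˡ?_) 𝒫 ¬all) in inj₂ (inj₂ (R , R∈𝒫 , inj₂ T⊈R))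
  splitting-member zero    T uT eq | yes all = inj₁ (T , uT , trans (sym (+-identityʳ _)) eq , all)
  splitting-member (suc d) T uT eq | yes all = inj₂ (someMember 𝒫)
    where
    someMember : ∀ 𝒬 → 𝒬 ≡ [] ⊎ ∃[ R ] (R ∈ 𝒬 × (length T < t ⊎ ¬ (T ⊆ R)))
    someMember []      = inj₁ refl
    someMember (R ∷ _) = inj₂ (R , here refl , inj₁ (subst (length T <_) eq (m<m+n (length T) (s≤s z≤n))))

  -- Here `d` counts the levels left until `suc t` classes are fixed. Since all of `𝒢` contains `T`,
  -- the splitting member is sought in the whole of `𝒫`. Each level costs a factor `ℓ`, the number
  -- of classes of `R`, and the last level is a star.
  branching-bound : ∀ d (T : List (Subset n)) 𝒢 → Unique T → length T + d ≡ suc t →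
    Star k ℓ T 𝒢 → 𝒢 ⊆ 𝒫 →
    CommonClasses t 𝒫 ⊎ (length 𝒢 * m ! ≤ ℓ ^ d * bound n k ℓ (suc t))
  branching-bound zero T 𝒢 uT eq star _ = inj₂ (begin
    length 𝒢 * m !           ≤⟨ star-bound m uT (trans (cong (_+ m) |T|≡1+t) t+1+m≡ℓ) star ⟩
    bound n k ℓ (length T)   ≡⟨ cong (bound n k ℓ) |T|≡1+t ⟩
    bound n k ℓ (suc t)      ≡⟨ *-identityˡ _ ⟨
    1 * bound n k ℓ (suc t)  ∎)
    where
    open ≤-Reasoning
    |T|≡1+t : length T ≡ suc t
    |T|≡1+t = trans (sym (+-identityʳ _)) eq
  branching-bound (suc d) T 𝒢 uT eq star 𝒢⊆𝒫
    with splitting-member d T uT (suc-injective (trans (sym (+-suc (length T) d)) eq))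
  ... | inj₁ common = inj₁ common
  ... | inj₂ (inj₁ refl) = inj₂ (≤-trans (≤-reflexive (cong (_* m !) (empty 𝒢 𝒢⊆𝒫))) z≤n)
    where
    empty : ∀ 𝒢 → 𝒢 ⊆ [] → length 𝒢 ≡ 0
    empty []      _  = refl
    empty (_ ∷ _) 𝒢⊆ = contradiction (𝒢⊆ (here refl)) ¬Any[]
  ... | inj₂ (inj₂ (R , R∈𝒫 , small)) = [ inj₁ , inj₂ ∘ combine ]′ (All-⊎ (All.tabulate branch))
    where
    open DoubleCounting (_∈ˡ?_ {n}) using (double-counting; degree)
    open ≤-Reasoning

    new : List (Subset n)
    new = filter (_∉ˡ? T) R

    Branch : Subset n → Set
    Branch A = length (filter (A ∈ˡ?_) 𝒢) * m ! ≤ ℓ ^ d * bound n k ℓ (suc t)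

    branch : ∀ {A} → A ∈ new → CommonClasses t 𝒫 ⊎ Branch A
    branch {A} A∈new = branching-bound d (A ∷ T) (filter (A ∈ˡ?_) 𝒢)
      (All.tabulate (λ { B∈T refl → proj₂ (∈-filter⁻ (_∉ˡ? T) {xs = R} A∈new) B∈T }) ∷ uT)
      (trans (sym (+-suc (length T) d)) eq) (Star-filter A star) (𝒢⊆𝒫 ∘ filter-⊆ (A ∈ˡ?_) 𝒢)

    T≤t : length T ≤ t
    T≤t = s≤s⁻¹ (subst (length T <_) eq (m<m+n (length T) (s≤s z≤n)))

    hit : ∀ {Q} → Q ∈ 𝒢 → 1 ≤ degree new Q
    hit {Q} Q∈𝒢 =
      let (A , A∈Q , A∈R , A∉T) = common-class-outside T≤t small
                                    (TIntersecting-lookup t≤ℓ family (𝒢⊆𝒫 Q∈𝒢) R∈𝒫)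
      in filter-some (_∈ˡ? Q) (lose (∈-filter⁺ (_∉ˡ? T) A∈R A∉T) A∈Q)

    combine : All Branch new → length 𝒢 * m ! ≤ ℓ ^ suc d * bound n k ℓ (suc t)
    combine branches = begin
      -- The inserted 1 is the lower degree from `hit`: every member of `𝒢` falls into at least one
      -- branch.
      length 𝒢 * m !                             ≡⟨ cong (length 𝒢 *_) (*-identityˡ (m !)) ⟨
      length 𝒢 * (1 * m !)                       ≤⟨ double-counting new 𝒢 (All.tabulate hit) branches ⟩
      length new * (ℓ ^ d * bound n k ℓ (suc t)) ≤⟨ *-monoˡ-≤ _ (length-filter (_∉ˡ? T) R) ⟩
      length R * (ℓ ^ d * bound n k ℓ (suc t))   ≡⟨ cong (_* _) (proj₁ (All.lookup (proj₁ family) R∈𝒫)) ⟩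
      ℓ * (ℓ ^ d * bound n k ℓ (suc t))          ≡⟨ *-assoc ℓ (ℓ ^ d) _ ⟨
      ℓ ^ suc d * bound n k ℓ (suc t)            ∎

-- Passing from `m !` to `suc m !` costs a factor `suc m`, and the branching costs `ℓ ^ suc t`. The
-- threshold on `n` makes the extra factor `(n ∸ t * k) C k` of `bound n k ℓ t` exceed their
-- product.
common-classes-or-small : ∀ {k ℓ t m n} → 1 ≤ k → t + suc m ≡ ℓ → ℓ * k + suc m * ℓ ^ suc t ≤ n →
  ∀ {𝒫} → IntersectingFamily k ℓ t n 𝒫 →
  CommonClasses t 𝒫 ⊎ length 𝒫 * suc m ! < bound n k ℓ t
common-classes-or-small {k} {ℓ} {t} {m} {n} 1≤k eq n-large {𝒫} family@(subs , distinct , _) =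
  [ inj₁ , inj₂ ∘ compare ]′
    (branching-bound (suc t) [] 𝒫 [] refl (subs , distinct , All.tabulate λ _ ()) id)
  where
  eq′ : suc t + m ≡ ℓ
  eq′ = trans (sym (+-suc t m)) eq

  open Branching eq′ family
  open ≤-Reasoning

  b : ℕ
  b = bound n k ℓ (suc t)

  rearrange : ∀ p q r → p * (q * r) ≡ q * (p * r)
  rearrange = solve-∀

  compare : length 𝒫 * m ! ≤ ℓ ^ suc t * b → length 𝒫 * suc m ! < bound n k ℓ t
  compare small = begin-strict
    length 𝒫 * (suc m * m !)      ≡⟨ rearrange (length 𝒫) (suc m) (m !) ⟩
    suc m * (length 𝒫 * m !)      ≤⟨ *-monoʳ-≤ (suc m) small ⟩
    suc m * (ℓ ^ suc t * b)       ≡⟨ *-assoc (suc m) (ℓ ^ suc t) b ⟨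
    suc m * ℓ ^ suc t * b         <⟨ *-monoˡ-< b {{>-nonZero (bound-positive (suc t) m 1≤k
                                       (m+n≤o⇒m≤o (ℓ * k) n-large) eq′)}}
                                       (d<[n∸sk]Ck _ 1≤k (subst (t <_) eq (m<m+n t (s≤s z≤n))) n-large) ⟩
    ((n ∸ t * k) C k) * b         ≡⟨ bound-step n k t m eq ⟨
    bound n k ℓ t                 ∎

-- Families with t common classes, and the theorem

common-classes⇒bound : ∀ {k ℓ t n} d → t + d ≡ ℓ → 0 < bound n k ℓ t →
  ∀ {𝒫} → IntersectingFamily k ℓ t n 𝒫 → CommonClasses t 𝒫 →
  (length 𝒫 * d ! ≤ bound n k ℓ t) × (length 𝒫 * d ! ≡ bound n k ℓ t → Canonical k ℓ t n 𝒫)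
-- Sizes and disjointness of the classes in `T` are read off from a member; the empty family has
-- none, but it misses the positive bound.
common-classes⇒bound d eq positive {[]} _ _ = z≤n , λ 0≡ → contradiction 0≡ (<⇒≢ positive)
common-classes⇒bound d eq positive {P₀ ∷ 𝒫} (subs@(sub₀ ∷ _) , distinct , _)
  (T , uT , refl , T⊆@(T⊆P₀ ∷ _)) =
  star-bound d uT eq star , λ tight →
    T , refl , classes-size sub₀ T⊆P₀ , classes-AllPairs sub₀ uT T⊆P₀ , λ P subP →
      mk⇔ (star-complete d uT eq star tight P subP)
          (λ P↭ → let (Q , Q∈ , P↭Q) = find P↭ in ∈-resp-↭ (↭-sym P↭Q) ∘ All.lookup T⊆ Q∈)
  where
  star = subs , distinct , T⊆

theorem2 : ∀ (k ℓ t : ℕ) → 1 ≤ k → 1 ≤ t → t ≤ ℓ ∸ 1 →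
    ∃[ n₀ ] (∀ (n : ℕ) → n₀ ≤ n → ∀ (𝒫 : List (List (Subset n))) →
    IntersectingFamily k ℓ t n 𝒫 →
    (length 𝒫 * (ℓ ∸ t) ! ≤ bound n k ℓ t) ×
    (length 𝒫 * (ℓ ∸ t) ! ≡ bound n k ℓ t → Canonical k ℓ t n 𝒫))
-- Truncated subtraction gives `0 ∸ 1 = 0`, so `t` would be both positive and zero.
theorem2 k zero    t 1≤k 1≤t t≤ℓ∸1 = contradiction (≤-trans 1≤t t≤ℓ∸1) λ ()
theorem2 k (suc ℓ) t 1≤k 1≤t t≤ℓ rewrite +-∸-assoc 1 t≤ℓ =
  suc ℓ * k + suc m * suc ℓ ^ suc t , λ n n-large 𝒫 family →
    [ common-classes⇒bound (suc m) eq
        (bound-positive t (suc m) 1≤k (m+n≤o⇒m≤o (suc ℓ * k) n-large) eq) family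
    -- Strictly below the bound, equality is impossible, so only families with common classes can be
    -- extremal.
    , (λ small → <⇒≤ small , λ tight → contradiction tight (<⇒≢ small))
    ]′ (common-classes-or-small 1≤k eq n-large family)
  where
  m : ℕ
  m = ℓ ∸ t
  eq : t + suc m ≡ suc ℓ
  eq = trans (+-suc t m) (cong suc (m+[n∸m]≡n t≤ℓ))
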